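{- For every fixed real $C>0$, \[ \max_{m\in\mathbb{N},\ m\le n^{C}} f(n,m)\ \le\ n^{1+o(1)}\qquad(n\to\infty). \]
   Context: $\mathbb{N}=\{1,2,3,\ldots\}$. For $n,m\in\mathbb{N}$, $f(n,m)$ denotes the least nonnegative integer $h$ such that the interval $(m,m+h]$ contains pairwise distinct integers $a_1,\ldots,a_n$ with $i\mid a_i$ for all $1\le i\le n$ (such an $h$ always exists). The term $o(1)$ is a quantity tending to $0$ as $n\to\infty$ with $C$ fixed; it may depend on $C$. That is, for every $C>0$ and every $\varepsilon>0$ there is $n_0$ such that $f(n,m)\le n^{1+\varepsilon}$ for all $n\ge n_0$ and all $m\in\mathbb{N}$ with $m\le n^{C}$. -}

module Defs where

open import Data.Fin as Fin using (Fin; toℕ; finToFun; funToFin)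
open import Data.Fin.Properties as Fin using (any?; all?; finToFun-funToFin; toℕ-injective)
open import Data.Integer as ℤ using (+_; -[1+_])
open import Data.Nat
open import Data.Nat.Divisibility using (_∣_; _∣?_; m∣m*n)
open import Data.Nat.Induction using (<-rec)
open import Data.Nat.Properties
open import Data.Product using (∃; _×_; _,_; proj₁; proj₂)
open import Data.Rational as ℚ using (ℚ; mkℚ; 0ℚ; 1ℚ)
open import Data.Rational.Properties as ℚ using (+-0-group)
open import Data.Sum using (_⊎_)
open import Algebra.Properties.Group +-0-group using (//-rightDividesˡ; //-rightDividesʳ)
open import Function using (_∘_; _⇔_; mk⇔; module Equivalence)
open import Function.Definitions using (Injective)
open import Level using (0ℓ)
open import Relation.Binary.PropositionalEquality
open import Relation.Nullary using (¬_; Dec; yes; no)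
open import Relation.Nullary.Decidable using (map′; _×-dec_; _→-dec_)
open import Relation.Unary using (Pred; Decidable)

-- Real numbers, as located two-sided Dedekind cuts.

record ℝ : Set₁ where
  field
    lower upper     : Pred ℚ 0ℓ
    lower-inhabited : ∃ lower
    upper-inhabited : ∃ upper
    lower-rounded   : ∀ p → lower p ⇔ (∃ λ q → p ℚ.< q × lower q)
    upper-rounded   : ∀ q → upper q ⇔ (∃ λ p → p ℚ.< q × upper p)
    disjoint        : ∀ q → ¬ (lower q × upper q)
    located         : ∀ p q → p ℚ.< q → lower p ⊎ upper q

Positive : ℝ → Set
Positive x = ℝ.lower x 0ℚ

private
  shift-< : ∀ {p q} → p ℚ.< q → p ℚ.- 1ℚ ℚ.< q ℚ.- 1ℚ
  shift-< = ℚ.+-monoˡ-< (ℚ.- 1ℚ)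

  unshift-<ˡ : ∀ {p q} → p ℚ.- 1ℚ ℚ.< q → p ℚ.< q ℚ.+ 1ℚ
  unshift-<ˡ {p} {q} lt =
    subst (ℚ._< q ℚ.+ 1ℚ) (//-rightDividesˡ 1ℚ p) (ℚ.+-monoˡ-< 1ℚ lt)

  unshift-<ʳ : ∀ {p q} → p ℚ.< q ℚ.- 1ℚ → p ℚ.+ 1ℚ ℚ.< q
  unshift-<ʳ {p} {q} lt =
    subst (p ℚ.+ 1ℚ ℚ.<_) (//-rightDividesˡ 1ℚ q) (ℚ.+-monoˡ-< 1ℚ lt)

1+_ : ℝ → ℝ
1+ x = record
  { lower           = λ p → lower (p ℚ.- 1ℚ)
  ; upper           = λ q → upper (q ℚ.- 1ℚ)
  ; lower-inhabited = let (p , l) = lower-inhabited in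
                      p ℚ.+ 1ℚ , subst lower (sym (//-rightDividesʳ 1ℚ p)) l
  ; upper-inhabited = let (q , u) = upper-inhabited in
                      q ℚ.+ 1ℚ , subst upper (sym (//-rightDividesʳ 1ℚ q)) u
  ; lower-rounded   = λ p → mk⇔
      (λ l → let (q , p<q , l′) = Equivalence.to (lower-rounded _) l in
             q ℚ.+ 1ℚ , unshift-<ˡ p<q , subst lower (sym (//-rightDividesʳ 1ℚ q)) l′)
      (λ (q , p<q , l) → Equivalence.from (lower-rounded _) (q ℚ.- 1ℚ , shift-< p<q , l))
  ; upper-rounded   = λ q → mk⇔
      (λ u → let (p , p<q , u′) = Equivalence.to (upper-rounded _) u in
             p ℚ.+ 1ℚ , unshift-<ʳ p<q , subst upper (sym (//-rightDividesʳ 1ℚ p)) u′)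
      (λ (p , p<q , u) → Equivalence.from (upper-rounded _) (p ℚ.- 1ℚ , shift-< p<q , u))
  ; disjoint        = λ q → disjoint (q ℚ.- 1ℚ)
  ; located         = λ p q p<q → located (p ℚ.- 1ℚ) (q ℚ.- 1ℚ) (shift-< p<q)
  }
  where
  open ℝ x

infix 4 _≤_^ℚ_ _≤_^ℝ_

-- k ≤ n ^ r for n ≥ 1, where n ^ (a/b) is the positive b-th root of n ^ a
-- (and n ^ (- a) = 1 / n ^ a); b-th powers are compared. The denominator
-- field of mkℚ stores b - 1, and -[1+ a ] is - (a + 1).
_≤_^ℚ_ : ℕ → ℕ → ℚ → Set
k ≤ n ^ℚ mkℚ (+ a)    b-1 _ = k ^ suc b-1 ≤ n ^ a
k ≤ n ^ℚ mkℚ -[1+ a ] b-1 _ = k ^ suc b-1 * n ^ suc a ≤ 1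

-- k ≤ n ^ x for n ≥ 1, where n ^ x is the infimum of n ^ r over the rationals
-- r > x.
_≤_^ℝ_ : ℕ → ℕ → ℝ → Set
k ≤ n ^ℝ x = ∀ r → ℝ.upper x r → k ≤ n ^ℚ r

-- (m , m + h] contains pairwise distinct a₁, …, aₙ with i ∣ aᵢ. The index
-- i : Fin n stands for the divisor suc (toℕ i) ∈ {1, …, n}.
Admissible : ℕ → ℕ → ℕ → Set
Admissible n m h = ∃ λ (a : Fin n → ℕ) →
  Injective _≡_ _≡_ a × (∀ i → (m < a i × a i ≤ m + h) × suc (toℕ i) ∣ a i)

IsLeast : Pred ℕ 0ℓ → Pred ℕ 0ℓ
IsLeast P h = P h × (∀ h′ → P h′ → h ≤ h′)

private
  least : ∀ {P : Pred ℕ 0ℓ} → Decidable P → ∃ P → ∃ (IsLeast P)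
  least {P} P? (k , Pk) = <-rec (λ k → P k → ∃ (IsLeast P)) step k Pk
    where
    step : ∀ k → (∀ {j} → j < k → P j → ∃ (IsLeast P)) → P k → ∃ (IsLeast P)
    step k rec Pk with anyUpTo? P? k
    ... | yes (j , j<k , Pj) = rec j<k Pj
    ... | no none = k , Pk , λ h′ Ph′ → ≮⇒≥ λ h′<k → none (h′ , h′<k , Ph′)

  injective? : ∀ {n} (a : Fin n → ℕ) → Dec (Injective _≡_ _≡_ a)
  injective? a = map′ (λ inj {i} {j} → inj i j) (λ inj i j → inj {i} {j})
    (all? λ i → all? λ j → (a i ≟ a j) →-dec (i Fin.≟ j))

  -- There are finitely many candidates aᵢ ≤ m + h, coded by Fin (suc (m + h) ^ n).
  admissible? : ∀ n m → Decidable (Admissible n m)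
  admissible? n m h = map′ (λ (c , p) → decode c , p) encode
    (any? λ c → injective? (decode c) ×-dec
      all? λ i → ((m <? decode c i) ×-dec (decode c i ≤? m + h)) ×-dec
                 (suc (toℕ i) ∣? decode c i))
    where
    decode : Fin (suc (m + h) ^ n) → Fin n → ℕ
    decode c i = toℕ (finToFun {suc (m + h)} {n} c i)

    Good : (Fin n → ℕ) → Set
    Good a = Injective _≡_ _≡_ a × (∀ i → (m < a i × a i ≤ m + h) × suc (toℕ i) ∣ a i)

    Good-resp : ∀ {a b} → a ≗ b → Good a → Good b
    Good-resp {a} {b} eq (inj , p) =
      (λ {i} {j} e → inj (trans (eq i) (trans e (sym (eq j))))) ,
      (λ i → subst (λ v → (m < v × v ≤ m + h) × suc (toℕ i) ∣ v) (eq i) (p i))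

    encode : ∃ Good → ∃ λ c → Good (decode c)
    encode (a , good@(_ , p)) = funToFin g , Good-resp (sym ∘ correct) good
      where
      bound : ∀ i → a i < suc (m + h)
      bound i = s≤s (proj₂ (proj₁ (p i)))

      g : Fin n → Fin (suc (m + h))
      g i = Fin.fromℕ< (bound i)

      correct : ∀ i → decode (funToFin g) i ≡ a i
      correct i = trans (cong toℕ (finToFun-funToFin g i)) (Fin.toℕ-fromℕ< (bound i))

  admissible-exists : ∀ n m → ∃ (Admissible n m)
  admissible-exists n m = n * suc m , (λ i → suc (toℕ i) * suc m) ,
    (λ {i} {j} e → toℕ-injective (suc-injective
      (*-cancelʳ-≡ (suc (toℕ i)) (suc (toℕ j)) (suc m) e))) ,
    (λ i → (m≤m+n (suc m) (toℕ i * suc m) ,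
            ≤-trans (*-monoˡ-≤ (suc m) (Fin.toℕ<n i)) (m≤n+m (n * suc m) m)) ,
           m∣m*n (suc m))

  f-exists : ∀ n m → ∃ (IsLeast (Admissible n m))
  f-exists n m = least (admissible? n m) (admissible-exists n m)

f : ℕ → ℕ → ℕ
f n m = proj₁ (f-exists n m)

f-isLeast : ∀ n m → IsLeast (Admissible n m) (f n m)
f-isLeast n m = proj₂ (f-exists n m)

module Submission where

-- An integer a ≤ n ^ O(1) has at most D = n ^ o(1) divisors: the prime powers
-- p ^ e in a with p ≥ 2 ^ k satisfy (e + 1) ^ k ≤ p ^ e, and each of the boundedly
-- many smaller primes costs at most a constant factor k ^ k.  In a block of n D
-- consecutive integers every i ≤ n has at least D multiples.  Assign multiples
-- greedily inside the block: every multiple of an unassigned i is then taken, so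
-- counting the pairs (i , multiple) shows that at most half of the i stay
-- unassigned.  About log₂ n consecutive blocks therefore serve all i ≤ n.

open import Defs
open import Algebra.Properties.CommutativeSemigroup using (x∙yz≈y∙xz)
open import Algebra.Properties.Group using (//-rightDividesˡ)
open import Data.Empty using (⊥-elim)
open import Data.Fin using (Fin; toℕ)
open import Data.Fin.Properties using (toℕ<n; toℕ-injective)
open import Data.Integer as ℤ using (-[1+_])
import Data.Integer.Properties as ℤ
open import Data.List using (List; []; _∷_; _++_; map; length; upTo; cartesianProductWith; concatMap)
open import Data.List.Membership.Propositional using (_∈_; _∉_)
open import Data.List.Membership.Propositional.Properties
open import Data.List.Properties using (length-map; length-++; length-++-sucʳ; length-upTo; map-++)
open import Data.List.Relation.Binary.Subset.Propositional using (_⊆_)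
open import Data.List.Relation.Unary.All as All using (All; []; _∷_)
import Data.List.Relation.Unary.All.Properties as All
open import Data.List.Relation.Unary.All.Properties using (All¬⇒¬Any; ¬Any⇒All¬)
import Data.List.Relation.Unary.AllPairs.Properties as AllPairs
open import Data.List.Relation.Unary.AllPairs using ([]; _∷_)
open import Data.List.Relation.Unary.Any using (here; there)
open import Data.List.Relation.Unary.Unique.Propositional using (Unique)
import Data.List.Relation.Unary.Unique.Propositional.Properties as Unique
open import Data.Nat
open import Data.Nat.Coprimality using (Coprime; coprime-divisor)
open import Data.Nat.Divisibility
open import Data.Nat.DivMod using (m≡m%n+[m/n]*n; m%n<n; m/n*n≤m)
open import Data.Nat.Induction using (<-rec)
open import Data.Nat.Primality using (Prime; prime?; prime⇒irreducible; prime⇒nonZero; prime⇒nonTrivial)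
open import Data.Nat.Primality.Factorisation using (factorise)
open import Data.Nat.Properties
open import Data.List.Membership.DecPropositional _≟_ using (_∈?_)
open import Data.Product using (∃; ∃₂; _×_; _,_; proj₁; proj₂)
open import Data.Rational as ℚ using (mkℚ; 0ℚ; 1ℚ)
import Data.Rational.Properties as ℚ
open import Data.Rational.Unnormalised as ℚᵘ using (*<*)
import Data.Rational.Unnormalised.Properties as ℚᵘ
open import Data.Sum as Sum using (_⊎_; inj₁; inj₂)
open import Function using (_∘_; module Equivalence)
open import Relation.Binary using (tri<; tri≈; tri>)
open import Relation.Binary.PropositionalEquality hiding (J)
open import Relation.Nullary using (¬_; Dec; yes; no; ¬?; _×-dec_)

-- The divisor bound.

^-distribʳ-* : ∀ m n k → (m * n) ^ k ≡ m ^ k * n ^ k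
^-distribʳ-* m n zero    = refl
^-distribʳ-* m n (suc k) =
  trans (cong (m * n *_) (^-distribʳ-* m n k)) ([m*n]*[o*p]≡[m*o]*[n*p] m n (m ^ k) (n ^ k))

n<2^n : ∀ n → n < 2 ^ n
n<2^n zero    = s≤s z≤n
n<2^n (suc n) = begin-strict
  suc n         ≤⟨ n<2^n n ⟩
  2 ^ n         <⟨ ^-monoʳ-< 2 ≤-refl (n<1+n n) ⟩
  2 ^ suc n     ∎
  where open ≤-Reasoning

-- Writing e = k q + r with r < k gives e + 1 ≤ k (q + 1) ≤ k 2 ^ q.
suc-^≤^*2^ : ∀ k .{{_ : NonZero k}} e → suc e ^ k ≤ k ^ k * 2 ^ e
suc-^≤^*2^ k e = begin
  suc e ^ k                  ≤⟨ ^-monoˡ-≤ k linear ⟩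
  (k * 2 ^ (e / k)) ^ k      ≡⟨ ^-distribʳ-* k (2 ^ (e / k)) k ⟩
  k ^ k * (2 ^ (e / k)) ^ k  ≡⟨ cong (k ^ k *_) (^-*-assoc 2 (e / k) k) ⟩
  k ^ k * 2 ^ (e / k * k)    ≤⟨ *-monoʳ-≤ (k ^ k) (^-monoʳ-≤ 2 (m/n*n≤m e k)) ⟩
  k ^ k * 2 ^ e              ∎
  where
  open ≤-Reasoning
  linear : suc e ≤ k * 2 ^ (e / k)
  linear = begin
    suc e                       ≡⟨ cong suc (m≡m%n+[m/n]*n e k) ⟩
    suc (e % k) + e / k * k     ≤⟨ +-monoˡ-≤ (e / k * k) (m%n<n e k) ⟩
    suc (e / k) * k             ≡⟨ *-comm (suc (e / k)) k ⟩
    k * suc (e / k)             ≤⟨ *-monoʳ-≤ k (n<2^n (e / k)) ⟩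
    k * 2 ^ (e / k)             ∎

-- Repetitions and further entries are allowed: the length of `ds` serves as an upper bound for the
-- number of divisors of `a`.
IncludesDivisors : ℕ → List ℕ → Set
IncludesDivisors a ds = ∀ {d} → d ∣ a → d ∈ ds

prime-∤⇒∣ : ∀ {p d b} → Prime p → ¬ p ∣ d → ∀ e → d ∣ p ^ e * b → d ∣ b
prime-∤⇒∣ {b = b} pr p∤d zero d∣ = subst (_ ∣_) (*-identityˡ b) d∣
prime-∤⇒∣ {p} {d} {b} pr p∤d (suc e) d∣ = prime-∤⇒∣ pr p∤d e
  (coprime-divisor coprime (subst (d ∣_) (*-assoc p (p ^ e) b) d∣))
  where
  coprime : Coprime d p
  coprime (j∣d , j∣p) with prime⇒irreducible pr j∣p
  ... | inj₁ j≡1 = j≡1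
  ... | inj₂ refl = ⊥-elim (p∤d j∣d)

-- A divisor of `p ^ suc e * b` either is prime to `p`, and then divides `b`, or is `p` times a
-- divisor of `p ^ e * b`. Thus each further factor `p` adds one copy of `ds`. The prime `p` may
-- also divide `b`; the list then has redundant entries.
divisors-p^e*b : ∀ {p b ds} → Prime p → IncludesDivisors b ds → ∀ e →
  ∃ λ es → IncludesDivisors (p ^ e * b) es × length es ≡ suc e * length ds
divisors-p^e*b {b = b} {ds} pr incl zero =
  ds , incl ∘ subst (_ ∣_) (*-identityˡ b) , sym (*-identityˡ (length ds))
divisors-p^e*b {p} {b} {ds} pr incl (suc e) with divisors-p^e*b pr incl e
... | es , incl′ , len = ds ++ map (p *_) es , all , len′
  where
  instance
    p≢0 = prime⇒nonZero pr
  all : IncludesDivisors (p ^ suc e * b) (ds ++ map (p *_) es)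
  all {d} d∣ with p ∣? d
  ... | no p∤d = ∈-++⁺ˡ (incl (prime-∤⇒∣ pr p∤d (suc e) d∣))
  ... | yes (divides d′ refl) = ∈-++⁺ʳ ds (subst (_∈ map (p *_) es) (*-comm p d′)
    (∈-map⁺ (p *_) (incl′ (*-cancelˡ-∣ p
      (subst₂ _∣_ (*-comm d′ p) (*-assoc p (p ^ e) b) d∣)))))
  len′ : length (ds ++ map (p *_) es) ≡ suc (suc e) * length ds
  len′ = trans (length-++ ds) (cong (length ds +_) (trans (length-map (p *_) es) len))

prime-divisor : ∀ a → 1 < a → ∃₂ λ p b → Prime p × a ≡ p * b × b < a
prime-divisor a 1<a with factorise a {{>-nonZero (<-trans z<s 1<a)}}
... | record { factors = [] ; isFactorisation = refl } = ⊥-elim (n≮n 1 1<a)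
... | record { factors = p ∷ ps ; isFactorisation = eq ; factorsPrime = pr ∷ _ } =
  p , _ , pr , eq ,
  subst (_ <_) (trans (*-comm _ p) (sym eq))
    (m<m*n _ p {{b≢0}} (nonTrivial⇒n>1 p {{prime⇒nonTrivial pr}}))
  where
  b≢0 = m*n≢0⇒n≢0 p {{subst NonZero eq (>-nonZero (<-trans z<s 1<a))}}

split-power : ∀ p → 1 < p → ∀ a → 0 < a → ∃₂ λ e b → a ≡ p ^ e * b × ¬ p ∣ b
split-power p 1<p = <-rec _ λ a rec 0<a → step a rec 0<a
  where
  step : ∀ a → (∀ {b} → b < a → 0 < b → ∃₂ λ e c → b ≡ p ^ e * c × ¬ p ∣ c) →
         0 < a → ∃₂ λ e b → a ≡ p ^ e * b × ¬ p ∣ b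
  step a rec 0<a with p ∣? a
  ... | no p∤a = 0 , a , sym (*-identityˡ a) , p∤a
  ... | yes (divides b refl)
    with rec (m<m*n b p {{b≢0}} 1<p) (>-nonZero⁻¹ b {{b≢0}})
    where b≢0 = m*n≢0⇒m≢0 b {{>-nonZero 0<a}}
  ... | e , c , refl , p∤c = suc e , c ,
    trans (*-comm (p ^ e * c) p) (sym (*-assoc p (p ^ e) c)) , p∤c

NoPrimeBelow : ℕ → ℕ → Set
NoPrimeBelow q a = ∀ {p} → Prime p → p < q → ¬ p ∣ a

-- The number of divisors is at most the `k`-th root of `K * a` when all prime factors of `a` are at
-- least `q`. Comparing `k`-th powers keeps this in ℕ. The threshold `q` serves as the induction
-- variable, running down from `2 ^ k`.
DivisorBound : ℕ → ℕ → ℕ → Set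
DivisorBound k K q = ∀ a → 0 < a → NoPrimeBelow q a →
  ∃ λ ds → IncludesDivisors a ds × length ds ^ k ≤ K * a

-- Strong induction on `a`: splitting off one prime `p` at most doubles the list, which multiplies
-- the `k`-th power of its length by `2 ^ k ≤ p`. So large primes pay for themselves and the
-- constant is 1.
divisorBound-rough : ∀ k → DivisorBound k 1 (2 ^ k)
divisorBound-rough k = <-rec _ step
  where
  step : ∀ a → (∀ {b} → b < a → 0 < b → NoPrimeBelow (2 ^ k) b →
                ∃ λ ds → IncludesDivisors b ds × length ds ^ k ≤ 1 * b) →
         0 < a → NoPrimeBelow (2 ^ k) a →
         ∃ λ ds → IncludesDivisors a ds × length ds ^ k ≤ 1 * a
  step a rec 0<a rough with 1 <? a
  ... | no 1≮a with refl ← ≤-antisym (≮⇒≥ 1≮a) 0<a =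
    1 ∷ [] , here ∘ ∣1⇒≡1 , ≤-reflexive (^-zeroˡ k)
  ... | yes 1<a with prime-divisor a 1<a
  ... | p , b , pr , refl , b<a
    with rec b<a (>-nonZero⁻¹ b {{m*n≢0⇒n≢0 p {{>-nonZero 0<a}}}})
             (λ pr′ lt d∣b → rough pr′ lt (∣-trans d∣b (n∣m*n p)))
  -- A single factor `p` is removed, with exponent 1; `b` may contain `p` again.
  ... | ds , incl , bound with divisors-p^e*b pr incl 1
  ... | es , incl′ , len =
    es , subst (λ x → IncludesDivisors (x * b) es) (*-identityʳ p) incl′ , (begin
      length es ^ k            ≡⟨ cong (_^ k) len ⟩
      (2 * length ds) ^ k      ≡⟨ ^-distribʳ-* 2 (length ds) k ⟩
      2 ^ k * length ds ^ k    ≤⟨ *-mono-≤ (≮⇒≥ λ p<q → rough pr p<q (m∣m*n b)) bound ⟩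
      p * (1 * b)              ≡⟨ cong (p *_) (*-identityˡ b) ⟩
      p * b                    ≡⟨ *-identityˡ (p * b) ⟨
      1 * (p * b)              ∎)
    where open ≤-Reasoning

-- If `q` is prime, its full power `q ^ e` is split off. This multiplies the list length by `e + 1`,
-- and `(e + 1) ^ k ≤ k ^ k * 2 ^ e ≤ k ^ k * q ^ e`, so the prime costs the constant `k ^
-- k` whatever `e` is. If `q` is not prime, `a` already has no prime factor below `suc q`.
divisorBound-pred : ∀ k .{{_ : NonZero k}} K q → DivisorBound k K (suc q) → DivisorBound k (k ^ k * K) q
divisorBound-pred k K q bound a 0<a rough with prime? q
... | no q∤ with bound a 0<a (λ pr p<1+q → rough pr (≤∧≢⇒< (s≤s⁻¹ p<1+q) (λ { refl → q∤ pr })))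
...   | ds , incl , le = ds , incl , ≤-trans le (*-monoˡ-≤ a (m≤n*m K (k ^ k) {{m^n≢0 k k}}))
divisorBound-pred k K q bound a 0<a rough | yes pr
  with split-power q (nonTrivial⇒n>1 q {{prime⇒nonTrivial pr}}) a 0<a
... | e , b , refl , q∤b
  with bound b (>-nonZero⁻¹ b {{m*n≢0⇒n≢0 (q ^ e) {{>-nonZero 0<a}}}}) rough′
  where
  rough′ : NoPrimeBelow (suc q) b
  rough′ {p} pr′ p<1+q p∣b with p ≟ q
  ... | yes refl = q∤b p∣b
  ... | no p≢q = rough pr′ (≤∧≢⇒< (s≤s⁻¹ p<1+q) p≢q) (∣-trans p∣b (n∣m*n (q ^ e)))
... | ds , incl , le with divisors-p^e*b pr incl e
... | es , incl′ , len = es , incl′ , (begin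
  length es ^ k                        ≡⟨ cong (_^ k) len ⟩
  (suc e * length ds) ^ k              ≡⟨ ^-distribʳ-* (suc e) (length ds) k ⟩
  suc e ^ k * length ds ^ k            ≤⟨ *-mono-≤ (suc-^≤^*2^ k e) le ⟩
  k ^ k * 2 ^ e * (K * b)              ≤⟨ *-monoˡ-≤ (K * b) (*-monoʳ-≤ (k ^ k) (^-monoˡ-≤ e 1<q)) ⟩
  k ^ k * q ^ e * (K * b)              ≡⟨ [m*n]*[o*p]≡[m*o]*[n*p] (k ^ k) (q ^ e) K b ⟩
  k ^ k * K * (q ^ e * b)              ∎)
  where
  open ≤-Reasoning
  1<q : 1 < q
  1<q = nonTrivial⇒n>1 q {{prime⇒nonTrivial pr}}

-- The threshold descends from `2 ^ k` to 0, where the condition on prime factors is vacuous. The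
-- number of steps depends on `k` alone, hence so does `K`.
divisor-bound : ∀ k .{{_ : NonZero k}} → ∃ λ K → ∀ a → 0 < a →
  ∃ λ ds → IncludesDivisors a ds × length ds ^ k ≤ K * a
divisor-bound k = descend (2 ^ k) 1 (divisorBound-rough k)
  where
  descend : ∀ q K → DivisorBound k K q → ∃ λ K → ∀ a → 0 < a →
            ∃ λ ds → IncludesDivisors a ds × length ds ^ k ≤ K * a
  descend zero    K bound = K , λ a 0<a → bound a 0<a (λ _ ())
  descend (suc q) K bound = descend q (k ^ k * K) (divisorBound-pred k K q bound)

-- Double counting with lists.

private
  variable
    A B C : Set

Unique∧⊆⇒length≤ : {xs ys : List A} → Unique xs → xs ⊆ ys → length xs ≤ length ys
Unique∧⊆⇒length≤ {xs = []} _ _ = z≤n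
Unique∧⊆⇒length≤ {xs = x ∷ xs} (x∉xs ∷ xs!) sub with ∈-∃++ (sub (here refl))
... | as , bs , refl =
  ≤-trans (s≤s (Unique∧⊆⇒length≤ xs! sub′)) (≤-reflexive (sym (length-++-sucʳ as x bs)))
  where
  sub′ : xs ⊆ as ++ bs
  sub′ {v} v∈xs with ∈-++⁻ as (sub (there v∈xs))
  ... | inj₁ v∈as = ∈-++⁺ˡ v∈as
  ... | inj₂ (here refl) = ⊥-elim (All¬⇒¬Any x∉xs v∈xs)
  ... | inj₂ (there v∈bs) = ∈-++⁺ʳ as v∈bs

length-cartesianProductWith : (f : A → B → C) (xs : List A) (ys : List B) →
  length (cartesianProductWith f xs ys) ≡ length xs * length ys
length-cartesianProductWith f [] ys = refl
length-cartesianProductWith f (x ∷ xs) ys = trans (length-++ (map (f x) ys))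
  (cong₂ _+_ (length-map (f x) ys) (length-cartesianProductWith f xs ys))

length-concatMap-≤ : (f : A → List B) {D : ℕ} {xs : List A} → All (λ x → length (f x) ≤ D) xs →
  length (concatMap f xs) ≤ length xs * D
length-concatMap-≤ f [] = z≤n
length-concatMap-≤ f {xs = x ∷ xs} (le ∷ les) =
  ≤-trans (≤-reflexive (length-++ (f x))) (+-mono-≤ le (length-concatMap-≤ f les))

-- The left side counts the pairs (z , g z j); all of them are of the form (z , u)
-- with u ∈ us and z ∈ preds u.
double-count : (g : A → ℕ → B) (preds : B → List A) {zs : List A} {us : List B} {L D : ℕ} →
  Unique zs → (∀ z {i j} → g z i ≡ g z j → i ≡ j) →
  (∀ {z j} → z ∈ zs → j < L → g z j ∈ us × z ∈ preds (g z j)) →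
  All (λ u → length (preds u) ≤ D) us →
  length zs * L ≤ length us * D
double-count {A = A} {B = B} g preds {zs} {us} {L} {D} zs! g-inj edge deg = begin
  length zs * L                                   ≡⟨ cong (length zs *_) (length-upTo L) ⟨
  length zs * length (upTo L)                     ≡⟨ length-cartesianProductWith out zs (upTo L) ⟨
  length (cartesianProductWith out zs (upTo L))   ≤⟨ Unique∧⊆⇒length≤ out! out⊆in ⟩
  length (concatMap into us)                      ≤⟨ length-concatMap-≤ into (All.map into-short deg) ⟩
  length us * D                                   ∎
  where
  open ≤-Reasoning
  out : A → ℕ → A × B
  out z j = z , g z j
  into : B → List (A × B)
  into u = map (_, u) (preds u)
  into-short : ∀ {u} → length (preds u) ≤ D → length (into u) ≤ D
  into-short {u} = ≤-trans (≤-reflexive (length-map (_, u) (preds u)))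
  out-inj : ∀ {w x y z} → out w y ≡ out x z → w ≡ x × y ≡ z
  out-inj {w} {x} {y} {z} eq with cong proj₁ eq
  ... | refl = refl , g-inj w (cong proj₂ eq)
  out! : Unique (cartesianProductWith out zs (upTo L))
  out! = Unique.cartesianProductWith⁺ out out-inj zs! (Unique.upTo⁺ L)
  out⊆in : cartesianProductWith out zs (upTo L) ⊆ concatMap into us
  out⊆in v∈ with ∈-cartesianProductWith⁻ out zs (upTo L) v∈
  ... | z , j , z∈ , j∈ , refl with edge z∈ (∈-upTo⁻ j∈)
  ... | u∈ , z∈preds = ∈-concat⁺′ (∈-map⁺ (_, g z j) z∈preds) (∈-map⁺ into u∈)

-- Greedy matchings.

-- `leftover-blocked` is the maximality of the matching: it supplies the pairs counted in the
-- halving argument. `length-sum` then turns a comparison of `leftover` with `matched` into one with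
-- `xs`.
record GreedyMatching {A B : Set} (R : A → B → Set) (xs : List A) : Set where
  field
    matched          : List (A × B)
    leftover         : List A
    related          : All (λ (x , b) → R x b) matched
    distinct         : Unique (map proj₂ matched)
    exhaustive       : ∀ {x} → x ∈ xs → x ∈ map proj₁ matched ⊎ x ∈ leftover
    leftover-⊆       : leftover ⊆ xs
    leftover-unique  : Unique xs → Unique leftover
    leftover-blocked : ∀ {x b} → x ∈ leftover → R x b → b ∈ map proj₂ matched
    length-sum       : length matched + length leftover ≡ length xs

greedy : {R : A → B → Set} →
  (∀ x (us : List B) → Dec (∃ λ b → R x b × b ∉ us)) → (∀ b (us : List B) → Dec (b ∈ us)) →
  ∀ xs → GreedyMatching R xs
greedy free? mem? [] = record
  { matched = [] ; leftover = [] ; related = [] ; distinct = [] ; exhaustive = λ ()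
  ; leftover-⊆ = λ () ; leftover-unique = λ _ → [] ; leftover-blocked = λ () ; length-sum = refl }
greedy {R = R} free? mem? (x ∷ xs) = extend (greedy free? mem? xs)
  where
  extend : GreedyMatching R xs → GreedyMatching R (x ∷ xs)
  extend M with free? x (map proj₂ (GreedyMatching.matched M))
  ... | yes (b , r , b∉) = record
    { matched          = (x , b) ∷ matched
    ; leftover         = leftover
    ; related          = r ∷ related
    ; distinct         = ¬Any⇒All¬ _ b∉ ∷ distinct
    ; exhaustive       = λ { (here refl) → inj₁ (here refl)
                           ; (there x∈) → Sum.map₁ there (exhaustive x∈) }
    ; leftover-⊆       = there ∘ leftover-⊆
    ; leftover-unique  = λ { (_ ∷ xs!) → leftover-unique xs! }
    -- The set of taken values only grows, so an element once blocked stays blocked.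
    ; leftover-blocked = λ z∈ → there ∘ leftover-blocked z∈
    ; length-sum       = cong suc length-sum
    }
    where open GreedyMatching M
  ... | no none = record
    { matched          = matched
    ; leftover         = x ∷ leftover
    ; related          = related
    ; distinct         = distinct
    ; exhaustive       = λ { (here refl) → inj₂ (here refl)
                           ; (there x∈) → Sum.map₂ there (exhaustive x∈) }
    ; leftover-⊆       = λ { (here refl) → here refl ; (there z∈) → there (leftover-⊆ z∈) }
    ; leftover-unique  = λ { (x∉ ∷ xs!) → ¬Any⇒All¬ _ (All¬⇒¬Any x∉ ∘ leftover-⊆) ∷ leftover-unique xs! }
    ; leftover-blocked = λ { (here refl) r → blocked r ; (there z∈) → leftover-blocked z∈ }
    ; length-sum       = trans (+-suc (length matched) (length leftover)) (cong suc length-sum)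
    }
    where
    open GreedyMatching M
    blocked : ∀ {b} → R x b → b ∈ map proj₂ matched
    blocked {b} r with mem? b (map proj₂ matched)
    ... | yes b∈ = b∈
    ... | no b∉ = ⊥-elim (none (b , r , b∉))

-- Multiples in consecutive blocks.

-- As in Admissible, the index i stands for the divisor i + 1.
MultipleIn : ℕ → ℕ → ℕ → ℕ → Set
MultipleIn x y i a = (x < a × a ≤ y) × suc i ∣ a

-- The multiples of `suc i` beyond `x` in increasing order, the first one at `j = 0`.
multiple : ℕ → ℕ → ℕ → ℕ
multiple x i j = suc i * (suc (x / suc i) + j)

multiple-injective : ∀ x i {j k} → multiple x i j ≡ multiple x i k → j ≡ k
multiple-injective x i {j} {k} eq =
  +-cancelˡ-≡ (suc (x / suc i)) j k (*-cancelˡ-≡ _ _ (suc i) eq)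

-- The quotient `x / suc i` is rounded down, so its successor times `suc i` exceeds `x`, while the
-- multiple with index `j` is at most `x + suc i * suc j`.
multiple-in : ∀ x {n L i j} → i < n → j < L → MultipleIn x (x + n * L) i (multiple x i j)
multiple-in x {n} {L} {i} {j} i<n j<L = (lower , upper) , m∣m*n _
  where
  open ≤-Reasoning
  lower : x < multiple x i j
  lower = begin-strict
    x                                       ≡⟨ m≡m%n+[m/n]*n x (suc i) ⟩
    x % suc i + x / suc i * suc i           <⟨ +-monoˡ-< _ (m%n<n x (suc i)) ⟩
    suc (x / suc i) * suc i                 ≡⟨ *-comm (suc (x / suc i)) (suc i) ⟩
    suc i * suc (x / suc i)                 ≤⟨ *-monoʳ-≤ (suc i) (m≤m+n _ j) ⟩
    multiple x i j                          ∎
  upper : multiple x i j ≤ x + n * L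
  upper = begin
    suc i * (suc (x / suc i) + j)           ≡⟨ cong (suc i *_) (+-suc (x / suc i) j) ⟨
    suc i * (x / suc i + suc j)             ≡⟨ *-distribˡ-+ (suc i) (x / suc i) (suc j) ⟩
    suc i * (x / suc i) + suc i * suc j     ≡⟨ cong (_+ suc i * suc j) (*-comm (suc i) (x / suc i)) ⟩
    x / suc i * suc i + suc i * suc j       ≤⟨ +-mono-≤ (m/n*n≤m x (suc i)) (*-mono-≤ i<n j<L) ⟩
    x + n * L                               ∎

freeMultiple? : ∀ x y i (us : List ℕ) → Dec (∃ λ a → MultipleIn x y i a × a ∉ us)
freeMultiple? x y i us with anyUpTo? (λ a → (x <? a) ×-dec (suc i ∣? a) ×-dec ¬? (a ∈? us)) (suc y)
... | yes (a , s≤s a≤y , x<a , i∣a , a∉) = yes (a , ((x<a , a≤y) , i∣a) , a∉)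
... | no none = no λ (a , ((x<a , a≤y) , i∣a) , a∉) → none (a , s≤s a≤y , x<a , i∣a , a∉)

-- `N` is a ceiling for all blocks, and `preds a` contains every index `i` whose divisor `suc i`
-- divides `a`. The same `D` bounds these lists and sets the block length `n * D`, so each index
-- below `n` has at least `D` multiples in a block.
module _ (n N D : ℕ) (0<D : 0 < D) (preds : ℕ → List ℕ)
  (preds-complete : ∀ {a i} → 0 < a → suc i ∣ a → i ∈ preds a)
  (preds-short : ∀ {a} → a ≤ N → length (preds a) ≤ D) where

  -- Each leftover index has `D` multiples in the block, all of them taken, and each taken value
  -- lies over at most `D` indices. Cancelling `D` shows that there are no more leftover than
  -- matched indices.
  greedy-halves : ∀ x {zs} → x + n * D ≤ N → Unique zs → (∀ {i} → i ∈ zs → i < n) →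
    (M : GreedyMatching (MultipleIn x (x + n * D)) zs) →
    2 * length (GreedyMatching.leftover M) ≤ length zs
  greedy-halves x {zs} ≤N zs! zs<n M = begin
    2 * length leftover                 ≡⟨ cong (length leftover +_) (+-identityʳ _) ⟩
    length leftover + length leftover   ≤⟨ +-monoˡ-≤ (length leftover) leftover≤matched ⟩
    length matched + length leftover    ≡⟨ length-sum ⟩
    length zs                           ∎
    where
    open ≤-Reasoning
    open GreedyMatching M
    count : length leftover * D ≤ length matched * D
    count = subst (λ l → length leftover * D ≤ l * D) (length-map proj₂ matched)
      (double-count (multiple x) preds (leftover-unique zs!) (multiple-injective x)
        (λ {z} {j} z∈ j<D → let r = multiple-in x (zs<n (leftover-⊆ z∈)) j<D in
          leftover-blocked z∈ r , preds-complete (≤-<-trans z≤n (proj₁ (proj₁ r))) (proj₂ r))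
        (All.tabulate λ u∈ → short (∈-map⁻ proj₂ u∈)))
      where
      short : ∀ {u} → (∃ λ p → p ∈ matched × u ≡ proj₂ p) → length (preds u) ≤ D
      short (_ , p∈ , refl) = preds-short (≤-trans (proj₂ (proj₁ (All.lookup related p∈))) ≤N)
    leftover≤matched : length leftover ≤ length matched
    leftover≤matched = *-cancelʳ-≤ (length leftover) (length matched) D {{>-nonZero 0<D}} count

  -- Induction on the number `J` of blocks: one greedy pass in the first block, then the leftover
  -- indices go to the remaining ones. The halving preserves the size condition, which for `J = 0`
  -- forces `zs` to be empty.
  match-in-blocks : ∀ J x zs → length zs < 2 ^ J → x + J * (n * D) ≤ N →
    Unique zs → (∀ {i} → i ∈ zs → i < n) →
    ∃ λ ps → All (λ (i , a) → MultipleIn x (x + J * (n * D)) i a) ps ×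
      Unique (map proj₂ ps) × (∀ {i} → i ∈ zs → i ∈ map proj₁ ps)
  match-in-blocks zero x [] lt ≤N zs! zs<n = [] , [] , [] , λ ()
  match-in-blocks zero x (_ ∷ _) (s≤s ()) ≤N zs! zs<n
  match-in-blocks (suc J) x zs lt ≤N zs! zs<n
    with greedy (freeMultiple? x (x + n * D)) _∈?_ zs
  ... | M with match-in-blocks J (x + n * D) leftover
         (*-cancelˡ-< 2 _ _ (≤-<-trans (greedy-halves x (≤-trans (m≤m+n _ _) ≤N′) zs! zs<n M) lt)) ≤N′
         (leftover-unique zs!) (zs<n ∘ leftover-⊆)
         where
         open GreedyMatching M
         ≤N′ : x + n * D + J * (n * D) ≤ N
         ≤N′ = ≤-trans (≤-reflexive (+-assoc x (n * D) (J * (n * D)))) ≤N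
  ... | ps , related′ , distinct′ , covers = matched ++ ps , all-related , all-distinct , all-covered
    where
    open GreedyMatching M
    assoc : x + n * D + J * (n * D) ≡ x + suc J * (n * D)
    assoc = +-assoc x (n * D) (J * (n * D))
    all-related : All (λ (i , a) → MultipleIn x (x + suc J * (n * D)) i a) (matched ++ ps)
    all-related = All.++⁺
      (All.map (λ ((lo , hi) , d) → (lo , ≤-trans hi (+-monoʳ-≤ x (m≤m+n (n * D) _))) , d) related)
      (All.map (λ ((lo , hi) , d) → (≤-<-trans (m≤m+n x _) lo , ≤-trans hi (≤-reflexive assoc)) , d) related′)
    all-distinct : Unique (map proj₂ (matched ++ ps))
    all-distinct = subst Unique (sym (map-++ proj₂ matched ps))
      (Unique.++⁺ distinct distinct′ disjoint)
      where
      -- Values from the first block are at most `x + n * D`; those from later blocks exceed it.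
      disjoint : ∀ {a} → ¬ (a ∈ map proj₂ matched × a ∈ map proj₂ ps)
      disjoint (a∈ , a∈′) with ∈-map⁻ proj₂ a∈ | ∈-map⁻ proj₂ a∈′
      ... | _ , p∈ , refl | _ , q∈ , eq = <⇒≱ (proj₁ (proj₁ (All.lookup related′ q∈)))
        (subst (_≤ x + n * D) eq (proj₂ (proj₁ (All.lookup related p∈))))
    all-covered : ∀ {i} → i ∈ zs → i ∈ map proj₁ (matched ++ ps)
    all-covered i∈ with exhaustive i∈
    ... | inj₁ i∈m = subst (_ ∈_) (sym (map-++ proj₁ matched ps)) (∈-++⁺ˡ i∈m)
    ... | inj₂ i∈l = subst (_ ∈_) (sym (map-++ proj₁ matched ps)) (∈-++⁺ʳ (map proj₁ matched) (covers i∈l))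

Unique-map-injective : (f : A → B) {xs : List A} → Unique (map f xs) →
  ∀ {x y} → x ∈ xs → y ∈ xs → f x ≡ f y → x ≡ y
Unique-map-injective f fxs! x∈ y∈ eq with ∈-AllPairs₂ (AllPairs.map⁻ fxs!) x∈ y∈
... | inj₁ x≡y = x≡y
... | inj₂ (inj₁ fx≢fy) = ⊥-elim (fx≢fy eq)
... | inj₂ (inj₂ fy≢fx) = ⊥-elim (fy≢fx (sym eq))

admissible-blocks : ∀ n m J D N → n < 2 ^ J → 0 < D → m + J * (n * D) ≤ N →
  (ds : ℕ → List ℕ) → (∀ b → IncludesDivisors (suc b) (ds b)) →
  (∀ {b} → b < N → length (ds b) ≤ D) →
  Admissible n m (J * (n * D))
admissible-blocks n m J D N n<2^J 0<D ≤N ds incl short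
  with match-in-blocks n N D 0<D preds preds-complete preds-short J m (upTo n)
         (subst (_< 2 ^ J) (sym (length-upTo n)) n<2^J) ≤N (Unique.upTo⁺ n) ∈-upTo⁻
  where
  preds : ℕ → List ℕ
  -- A default value: 0 is never in a block, since block elements exceed `x`.
  preds zero    = []
  -- `pred` converts a divisor `suc i` into its index `i`.
  preds (suc b) = map pred (ds b)
  preds-complete : ∀ {a i} → 0 < a → suc i ∣ a → i ∈ preds a
  preds-complete {suc b} _ i∣a = ∈-map⁺ pred (incl b i∣a)
  preds-short : ∀ {a} → a ≤ N → length (preds a) ≤ D
  preds-short {zero}  _   = z≤n
  preds-short {suc b} b<N = ≤-trans (≤-reflexive (length-map pred (ds b))) (short b<N)
... | ps , related , distinct , covers =
  proj₂ ∘ pair , injective , λ i →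
    subst (λ j → MultipleIn m (m + J * (n * D)) j (proj₂ (pair i))) (sym (index i)) (All.lookup related (pair∈ i))
  where
  found : ∀ i → ∃ λ p → p ∈ ps × toℕ i ≡ proj₁ p
  found i = ∈-map⁻ proj₁ (covers (∈-upTo⁺ (toℕ<n i)))
  pair : Fin n → ℕ × ℕ
  pair = proj₁ ∘ found
  pair∈ : ∀ i → pair i ∈ ps
  pair∈ = proj₁ ∘ proj₂ ∘ found
  index : ∀ i → toℕ i ≡ proj₁ (pair i)
  index = proj₂ ∘ proj₂ ∘ found
  -- The values in `ps` are pairwise distinct, so equal values come from the same pair, whose first
  -- component recovers the index.
  injective : ∀ {i j} → proj₂ (pair i) ≡ proj₂ (pair j) → i ≡ j
  injective {i} {j} eq = toℕ-injective (trans (index i) (trans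
    (cong proj₁ (Unique-map-injective proj₂ distinct (pair∈ i) (pair∈ j) eq)) (sym (index j))))

-- Choice of the parameters.

^-cancelʳ-≤ : ∀ k .{{_ : NonZero k}} {m n} → m ^ k ≤ n ^ k → m ≤ n
^-cancelʳ-≤ k le = ≮⇒≥ λ n<m → <⇒≱ (^-monoˡ-< k n<m) le

m≤m^n : ∀ m n .{{_ : NonZero m}} .{{_ : NonZero n}} → m ≤ m ^ n
m≤m^n m n = ≤-trans (≤-reflexive (sym (^-identityʳ m))) (^-monoʳ-≤ m (>-nonZero⁻¹ n))

binary-size : ∀ n → 0 < n → ∃ λ e → 2 ^ e ≤ n × n < 2 ^ suc e
binary-size (suc zero) _ = 0 , ≤-refl , ≤-refl
binary-size (suc n@(suc _)) _ with binary-size n z<s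
... | e , lo , hi with suc n <? 2 ^ suc e
...   | yes lt = e , m≤n⇒m≤1+n lo , lt
...   | no ≮ = suc e , ≮⇒≥ ≮ , ≤-<-trans hi (^-monoʳ-< 2 ≤-refl (n<1+n (suc e)))

-- `D` is the maximum of 1 and the values of `ℓ` below `N`, which replaces taking a `k`-th root of
-- `M`. The successor in `suc M` leaves room for `D = 1` when `M = 0`.
max-bounded-power : ∀ k M N (ℓ : ℕ → ℕ) → (∀ {b} → b < N → ℓ b ^ k ≤ M) →
  ∃ λ D → 0 < D × (∀ {b} → b < N → ℓ b ≤ D) × D ^ k ≤ suc M
max-bounded-power k M zero    ℓ bound = 1 , ≤-refl , (λ ()) , ≤-trans (≤-reflexive (^-zeroˡ k)) (s≤s z≤n)
max-bounded-power k M (suc N) ℓ bound with max-bounded-power k M N ℓ (bound ∘ m≤n⇒m≤1+n)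
... | D , 0<D , ≤D , D^k with ℓ N ≤? D
...   | yes ℓN≤D = D , 0<D , extend , D^k
  where
  extend : ∀ {b} → b < suc N → ℓ b ≤ D
  extend (s≤s b≤N) with m≤n⇒m<n∨m≡n b≤N
  ... | inj₁ b<N  = ≤D b<N
  ... | inj₂ refl = ℓN≤D
...   | no ℓN≰D = ℓ N , ≤-<-trans z≤n (≰⇒> ℓN≰D) , extend , m≤n⇒m≤1+n (bound ≤-refl)
  where
  extend : ∀ {b} → b < suc N → ℓ b ≤ ℓ N
  extend (s≤s b≤N) with m≤n⇒m<n∨m≡n b≤N
  ... | inj₁ b<N  = ≤-trans (≤D b<N) (<⇒≤ (≰⇒> ℓN≰D))
  ... | inj₂ refl = ≤-refl

-- This is the exponent `1 + 1/t` with roots cleared. The blocks give `f n m ≤ J * (n * D)`, and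
-- both the logarithmic `J` and the divisor bound `D` are at most the `2t`-th root of `n`.
f-bound : ∀ c t .{{_ : NonZero t}} → ∃ λ n₀ → ∀ n → n₀ ≤ n → ∀ m → m ≤ n ^ c → f n m ^ t ≤ n ^ suc t
f-bound c t = n₀ , bound
  where
  instance
    2t≢0 : NonZero (2 * t)
    2t≢0 = m*n≢0 2 t
    4t≢0 : NonZero (2 * t * 2)
    4t≢0 = m*n≢0 (2 * t) 2
    k≢0 : NonZero (2 * t * (c + 5))
    k≢0 = m*n≢0 (2 * t) (c + 5) {{2t≢0}} {{>-nonZero (≤-trans (s≤s z≤n) (m≤n+m 5 c))}}
  k K n₀ : ℕ
  -- The numbers involved are at most `n ^ (c + 4)`, and the constant `suc K ≤ n` costs one more
  -- factor `n`. So `D ^ k ≤ n ^ (c + 5)`, that is `D ^ (2 * t) ≤ n`.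
  k = 2 * t * (c + 5)
  K = proj₁ (divisor-bound k)
  -- The summands ensure that 2, `suc K` and the constant in the estimate of `J` are each at most
  -- `n`.
  n₀ = 2 + suc K + (2 * t * 2) ^ (2 * t * 2)
  ds : ℕ → List ℕ
  ds b = proj₁ (proj₂ (divisor-bound k) (suc b) z<s)
  ds-incl : ∀ b → IncludesDivisors (suc b) (ds b)
  ds-incl b = proj₁ (proj₂ (proj₂ (divisor-bound k) (suc b) z<s))
  ds-short : ∀ b → length (ds b) ^ k ≤ K * suc b
  ds-short b = proj₂ (proj₂ (proj₂ (divisor-bound k) (suc b) z<s))

  bound : ∀ n → n₀ ≤ n → ∀ m → m ≤ n ^ c → f n m ^ t ≤ n ^ suc t
  bound n n₀≤n m m≤n^c
    with binary-size n (≤-trans (s≤s z≤n) n₀≤n)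
       | max-bounded-power k (K * n ^ (c + 4)) (n ^ (c + 4)) (length ∘ ds)
           (λ {b} b<N → ≤-trans (ds-short b) (*-monoʳ-≤ K b<N))
  ... | e , 2^e≤n , n<2^1+e | D , 0<D , ≤D , D^k = begin
    f n m ^ t                  ≤⟨ ^-monoˡ-≤ t (proj₂ (f-isLeast n m) _ admissible) ⟩
    (J * (n * D)) ^ t          ≡⟨ cong (_^ t) (x∙yz≈y∙xz *-commutativeSemigroup J n D) ⟩
    (n * (J * D)) ^ t          ≡⟨ ^-distribʳ-* n (J * D) t ⟩
    n ^ t * (J * D) ^ t        ≤⟨ *-monoʳ-≤ (n ^ t) JD ⟩
    n ^ t * n                  ≡⟨ *-comm (n ^ t) n ⟩
    n ^ suc t                  ∎
    where
    open ≤-Reasoning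
    J N : ℕ
    J = suc e
    -- Large enough, as `J` and `D` are at most `n` and `n ^ c + n ^ 3 ≤ 2 * n ^ (c + 3)`.
    N = n ^ (c + 4)
    2≤n : 2 ≤ n
    2≤n = ≤-trans (s≤s (s≤s z≤n)) n₀≤n
    instance
      n≢0 : NonZero n
      n≢0 = >-nonZero (≤-trans (s≤s z≤n) 2≤n)
      D≢0 : NonZero D
      D≢0 = >-nonZero 0<D
    1+K≤n : suc K ≤ n
    1+K≤n = ≤-trans (≤-trans (m≤n+m (suc K) 2) (m≤m+n (2 + suc K) _)) n₀≤n
    J^2t : J ^ (2 * t) ≤ n
    J^2t = ^-cancelʳ-≤ 2 (begin
      (J ^ (2 * t)) ^ 2                          ≡⟨ ^-*-assoc J (2 * t) 2 ⟩
      -- Doubling the exponent gives the bound `n * n`: one factor absorbs the constant, the other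
      -- `2 ^ e`.
      J ^ (2 * t * 2)                            ≤⟨ suc-^≤^*2^ (2 * t * 2) e ⟩
      (2 * t * 2) ^ (2 * t * 2) * 2 ^ e          ≤⟨ *-mono-≤ (≤-trans (m≤n+m _ (2 + suc K)) n₀≤n) 2^e≤n ⟩
      n * n                                      ≡⟨ cong (n *_) (*-identityʳ n) ⟨
      n ^ 2                                      ∎)
    D^2t : D ^ (2 * t) ≤ n
    D^2t = ^-cancelʳ-≤ (c + 5) {{>-nonZero (≤-trans (s≤s z≤n) (m≤n+m 5 c))}} (begin
      (D ^ (2 * t)) ^ (c + 5)     ≡⟨ ^-*-assoc D (2 * t) (c + 5) ⟩
      D ^ k                       ≤⟨ D^k ⟩
      1 + K * N                   ≤⟨ +-monoˡ-≤ (K * N) (m^n>0 n (c + 4)) ⟩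
      suc K * N                   ≤⟨ *-monoˡ-≤ N 1+K≤n ⟩
      n ^ suc (c + 4)             ≡⟨ cong (n ^_) (+-suc c 4) ⟨
      n ^ (c + 5)                 ∎)
    JD : (J * D) ^ t ≤ n
    JD = ^-cancelʳ-≤ 2 (begin
      ((J * D) ^ t) ^ 2               ≡⟨ ^-*-assoc (J * D) t 2 ⟩
      (J * D) ^ (t * 2)               ≡⟨ cong ((J * D) ^_) (*-comm t 2) ⟩
      (J * D) ^ (2 * t)               ≡⟨ ^-distribʳ-* J D (2 * t) ⟩
      J ^ (2 * t) * D ^ (2 * t)       ≤⟨ *-mono-≤ J^2t D^2t ⟩
      n * n                           ≡⟨ cong (n *_) (*-identityʳ n) ⟨
      n ^ 2                           ∎)
    J≤n : J ≤ n
    J≤n = ≤-trans (m≤m^n J (2 * t)) J^2t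
    D≤n : D ≤ n
    D≤n = ≤-trans (m≤m^n D (2 * t)) D^2t
    ≤N : m + J * (n * D) ≤ N
    ≤N = begin
      m + J * (n * D)                 ≤⟨ +-mono-≤ m≤n^c (*-mono-≤ J≤n (*-monoʳ-≤ n D≤n)) ⟩
      n ^ c + n * (n * n)             ≡⟨ cong (λ x → n ^ c + n * (n * x)) (*-identityʳ n) ⟨
      n ^ c + n ^ 3                   ≤⟨ +-mono-≤ (^-monoʳ-≤ n (m≤m+n c 3)) (^-monoʳ-≤ n (m≤n+m 3 c)) ⟩
      n ^ (c + 3) + n ^ (c + 3)       ≡⟨ cong (n ^ (c + 3) +_) (+-identityʳ _) ⟨
      2 * n ^ (c + 3)                 ≤⟨ *-monoˡ-≤ (n ^ (c + 3)) 2≤n ⟩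
      n ^ suc (c + 3)                 ≡⟨ cong (n ^_) (+-suc c 3) ⟨
      N                               ∎
    admissible : Admissible n m (J * (n * D))
    admissible = admissible-blocks n m J D N n<2^1+e 0<D ≤N ds ds-incl ≤D

-- Passage to real exponents.

-- Any rational in the upper cut of `C` serves: its numerator is taken as `c`, dropping the root by
-- `m ≤ m ^ suc b`. A negative rational forces `m ≤ 1`, hence the exponent 0.
^ℝ⇒^ : (C : ℝ) → ∃ λ c → ∀ n → 1 ≤ n → ∀ m → 1 ≤ m → m ≤ n ^ℝ C → m ≤ n ^ c
^ℝ⇒^ C with ℝ.upper-inhabited C
... | q@(mkℚ (ℤ.+ a) b _) , Cq = a , λ n 1≤n m 1≤m le →
  ≤-trans (m≤m^n m (suc b) {{>-nonZero 1≤m}}) (le q Cq)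
... | q@(mkℚ -[1+ a ] b _) , Cq = 0 , λ n 1≤n m 1≤m le →
  ≤-trans (m≤m^n m (suc b) {{>-nonZero 1≤m}})
    (≤-trans (m≤m*n _ (n ^ suc a) {{m^n≢0 n (suc a) {{>-nonZero 1≤n}}}}) (le q Cq))

lower<upper : ∀ (x : ℝ) {p q} → ℝ.lower x p → ℝ.upper x q → p ℚ.< q
lower<upper x {p} {q} lo up with ℚ.<-cmp p q
... | tri< p<q _ _ = p<q
... | tri≈ _ refl _ = ⊥-elim (ℝ.disjoint x p (lo , up))
... | tri> _ _ q<p = ⊥-elim (ℝ.disjoint x q (Equivalence.from (ℝ.lower-rounded x q) (p , q<p , lo) , up))

-- t is the denominator of q, so that q ≥ 1/t.
^⇒^ℚ : ∀ q → 0ℚ ℚ.< q → ∃ λ t → NonZero t ×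
  (∀ k n r → 1 ≤ n → q ℚ.< r ℚ.- 1ℚ → k ^ t ≤ n ^ suc t → k ≤ n ^ℚ r)
^⇒^ℚ (mkℚ (ℤ.+ zero) d _) (ℚ.*<* (ℤ.+<+ ()))
^⇒^ℚ (mkℚ -[1+ _ ] d _) (ℚ.*<* ())
^⇒^ℚ q@(mkℚ (ℤ.+ suc p) d _) _ = suc d , _ , convert
  where
  convert : ∀ k n r → 1 ≤ n → q ℚ.< r ℚ.- 1ℚ → k ^ suc d ≤ n ^ suc (suc d) → k ≤ n ^ℚ r
  convert k n r 1≤n q<r-1 le with q+1<r
    where
    q+1<r : ℚ.toℚᵘ q ℚᵘ.+ ℚ.toℚᵘ 1ℚ ℚᵘ.< ℚ.toℚᵘ r
    q+1<r = ℚᵘ.<-respˡ-≃ (ℚ.toℚᵘ-homo-+ q 1ℚ) (ℚ.toℚᵘ-mono-<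
      (subst (q ℚ.+ 1ℚ ℚ.<_) (//-rightDividesˡ ℚ.+-0-group 1ℚ r) (ℚ.+-monoˡ-< 1ℚ q<r-1)))
  convert k n (mkℚ (ℤ.+ a) b _) 1≤n _ le | *<* lt = ^-cancelʳ-≤ t (begin
    (k ^ suc b) ^ t           ≡⟨ ^-*-assoc k (suc b) t ⟩
    k ^ (suc b * t)           ≡⟨ cong (k ^_) (*-comm (suc b) t) ⟩
    k ^ (t * suc b)           ≡⟨ ^-*-assoc k t (suc b) ⟨
    (k ^ t) ^ suc b           ≤⟨ ^-monoˡ-≤ (suc b) le ⟩
    (n ^ suc t) ^ suc b       ≡⟨ ^-*-assoc n (suc t) (suc b) ⟩
    n ^ (suc t * suc b)       ≤⟨ ^-monoʳ-≤ n {{>-nonZero 1≤n}} exponents ⟩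
    n ^ (a * t)               ≡⟨ ^-*-assoc n a t ⟨
    (n ^ a) ^ t               ∎)
    where
    open ≤-Reasoning
    t = suc d
    exponents : suc t * suc b ≤ a * t
    exponents = begin
      -- The terms `p * 1`, `d + 0` and `d * 1` come from unnormalised addition: `q + 1` has
      -- numerator `suc p + t`, at least `suc t`, and denominator `t`.
      suc t * suc b                        ≤⟨ *-monoˡ-≤ (suc b) (s≤s t≤) ⟩
      suc (p * 1 + suc (d + 0)) * suc b    ≤⟨ <⇒≤ lt′ ⟩
      a * suc (d * 1)                      ≡⟨ cong (λ x → a * suc x) (*-identityʳ d) ⟩
      a * t                                ∎
      where
      t≤ : t ≤ p * 1 + suc (d + 0)
      t≤ = ≤-trans (s≤s (m≤m+n d 0)) (m≤n+m (suc (d + 0)) (p * 1))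
      lt′ : suc (p * 1 + suc (d + 0)) * suc b < a * suc (d * 1)
      lt′ = ℤ.drop‿+<+ (subst₂ ℤ._<_ (sym (ℤ.pos-* (suc (p * 1 + suc (d + 0))) (suc b)))
        (sym (ℤ.pos-* a (suc (d * 1)))) lt)
  convert k n (mkℚ -[1+ a ] b _) 1≤n _ le | *<* ()

proposition6p2 : (C : ℝ) → Positive C →
    (ε : ℝ) → Positive ε →
    ∃ λ (n₀ : ℕ) → ∀ (n : ℕ) → 1 ≤ n → n₀ ≤ n →
    ∀ (m : ℕ) → 1 ≤ m → m ≤ n ^ℝ C → f n m ≤ n ^ℝ (1+ ε)
proposition6p2 C _ ε ε>0 =
  let c , C≤c = ^ℝ⇒^ C
      -- Roundedness yields a rational `q` with `0 < q < ε`. Every `r` in the upper cut of `1+ ε`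
      -- then has `r - 1 > q ≥ 1/t`, so the exponent `1 + 1/t` is below `r`.
      q , 0<q , q<ε = Equivalence.to (ℝ.lower-rounded ε 0ℚ) ε>0
      t , t≢0 , convert = ^⇒^ℚ q 0<q
      n₀ , bound = f-bound c t {{t≢0}}
  in n₀ , λ n 1≤n n₀≤n m 1≤m m≤n^C r 1+ε<r →
    convert (f n m) n r 1≤n (lower<upper ε q<ε 1+ε<r) (bound n n₀≤n m (C≤c n 1≤n m 1≤m m≤n^C))
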